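{- Let $T\colon\mathsf{Set}\to\mathsf{Set}$ be a functor composed from a set $\mathcal{H}$ of monomorphism-preserving finitary functors, with flattening $\bar T\colon\mathsf{Set}^n\to\mathsf{Set}^n$, and let $(X,\xi)$ be a finite $T$-coalgebra. If $q\colon\mathsf{Factor}(X,\xi)\twoheadrightarrow(Y,\zeta)$ represents the simple quotient of the $\bar T$-coalgebra $\mathsf{Factor}(X,\xi)$, then $\mathsf{Comp}(q)\colon(X,\xi)\to\mathsf{Comp}(Y,\zeta)$ represents the simple quotient of $(X,\xi)$.
   Context: Let $\mathcal{H}$ be a set of functors $H\colon\mathsf{Set}^k\to\mathsf{Set}$ (with possibly different arities $k<\omega$), each preserving monomorphisms and finitary (preserving filtered colimits). Terms are generated by $T::=(-)\mid H(T,\dots,T)$ with $H\in\mathcal{H}$; a term denotes a functor $\mathsf{Set}\to\mathsf{Set}$: $(-)X=X$ and $H(G_1,\dots,G_k)X=H(G_1X,\dots,G_kX)$. Let $T\neq(-)$, and let $n$ be the number of non-leaf subterms of $T$ (occurrences of subterms other than $(-)$, including $T$ itself; duplicates are counted separately). Fix a bijection $f$ from the non-leaf subterms to $\{1,\dots,n\}$ with $f(T)=1$, and additionally write $f(-)=1$ (but $f^{ -1}(1)=T$). The flattening $\bar T\colon\mathsf{Set}^n\to\mathsf{Set}^n$ is $(\bar T(X_1,\dots,X_n))_i=H(X_{f(G_1)},\dots,X_{f(G_k)})$ where $f^{ -1}(i)=H(G_1,\dots,G_k)$. $\mathsf{Comp}\colon\mathsf{Coalg}(\bar T)\to\mathsf{Coalg}(T)$: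 for a $\bar T$-coalgebra with carrier $(X_1,\dots,X_n)$ and structure $(\xi_1,\dots,\xi_n)$ define $c_{T'}\colon X_{f(T')}\to T'X_1$ for each subterm $T'$ inductively by $c_{(-)}=\mathrm{id}_{X_1}$ and $c_{H(G_1,\dots,G_k)}=H(c_{G_1},\dots,c_{G_k})\cdot\xi_{f(H(G_1,\dots,G_k))}$. Then $\mathsf{Comp}$ sends this coalgebra to $(X_1,c_T\colon X_1\to TX_1)$, and a morphism $(h_1,\dots,h_n)$ to $h_1$. $\mathsf{Factor}$: for a finite $T$-coalgebra $(X,\xi)$ choose finite sets $X_1,\dots,X_n$, maps $m_{T'}\colon X_{f(T')}\to T'X$ for every subterm $T'$, and maps $\bar\xi_{T'}\colon X_{f(T')}\to H(X_{f(G_1)},\dots,X_{f(G_k)})$ for every non-leaf subterm $T'=H(G_1,\dots,G_k)$, recursively down the syntax tree: $X_1:=X$, $m_T:=\xi$, $m_{(-)}:=\mathrm{id}_X$; for $T'=H(G_1,\dots,G_k)$ with $m_{T'}$ already chosen, choose for each $G_i\neq(-)$ a minimal finite subset $m_{G_i}\colon X_{f(G_i)}\hookrightarrow G_iX$, and a map $\bar\xi_{T'}$, such that $m_{T'}=H(m_{G_1},\dots,m_{G_k})\cdot\bar\xi_{T'}$ (possible since the functors are finitary). $\mathsf{Factor}(X,\xi)$ is the $\bar T$-coalgebra on $(X_1,\dots,X_n)$ whose $i$-th structure component is $\bar\xi_{f^{ -1}(i)}$. It satisfies $\mathsf{Comp}(\mathsf{Factor}(X,\xi))=(X,\xi)$.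 A coalgebra morphism $(X,\xi)\to(Y,\zeta)$ for an endofunctor $F$ is a morphism $h$ with $\zeta\cdot h=Fh\cdot\xi$; a quotient is a coalgebra morphism that is (componentwise) surjective; a coalgebra is simple if all its quotients are isomorphisms; the simple quotient of a coalgebra is its (unique up to isomorphism) quotient with simple codomain. -}

module Defs where

open import Level using (Level; suc; _⊔_; Lift)
open import Data.Nat.Base using (ℕ)
open import Data.Fin.Base using (Fin; zero)
open import Data.Product.Base using (Σ-syntax; ∃-syntax; _×_; _,_)
open import Data.Vec.Functional using (Vector; _∷_)
open import Function.Bundles using (Func; Inverse; _↔_)
open import Function.Definitions using (Surjective)
import Function.Construct.Composition as Composition
import Function.Construct.Identity as Identity
import Function.Relation.Binary.Setoid.Equality as FuncEq
open import Relation.Binary.Bundles using (Setoid)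
open import Relation.Binary.Core using (Rel)
open import Relation.Binary.PropositionalEquality.Core using (_≡_; subst)
import Relation.Binary.PropositionalEquality.Properties as ≡
open import Relation.Binary.Structures using (IsEquivalence)

private
  variable
    o a e o′ a′ e′ o″ a″ e″ s ℓ : Level

record Category o a e : Set (suc (o ⊔ a ⊔ e)) where
  infix  4 _≈_ _⇒_
  infixr 9 _∘_
  field
    Obj       : Set o
    _⇒_       : Rel Obj a
    _≈_       : ∀ {A B} → Rel (A ⇒ B) e
    id        : ∀ {A} → A ⇒ A
    _∘_       : ∀ {A B C} → B ⇒ C → A ⇒ B → A ⇒ C
    equiv     : ∀ {A B} → IsEquivalence (_≈_ {A} {B})
    assoc     : ∀ {A B C D} (f : A ⇒ B) (g : B ⇒ C) (h : C ⇒ D) →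
                (h ∘ g) ∘ f ≈ h ∘ (g ∘ f)
    identityˡ : ∀ {A B} (f : A ⇒ B) → id ∘ f ≈ f
    identityʳ : ∀ {A B} (f : A ⇒ B) → f ∘ id ≈ f
    ∘-resp-≈  : ∀ {A B C} {f f′ : B ⇒ C} {g g′ : A ⇒ B} →
                f ≈ f′ → g ≈ g′ → f ∘ g ≈ f′ ∘ g′

record Functor (C : Category o a e) (D : Category o′ a′ e′)
       : Set (o ⊔ a ⊔ e ⊔ o′ ⊔ a′ ⊔ e′) where
  private
    module C = Category C
    module D = Category D
  field
    F₀           : C.Obj → D.Obj
    F₁           : ∀ {A B} → A C.⇒ B → F₀ A D.⇒ F₀ B
    identity     : ∀ {A} → F₁ (C.id {A}) D.≈ D.id
    homomorphism : ∀ {A B E} (f : A C.⇒ B) (g : B C.⇒ E) →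
                   F₁ (g C.∘ f) D.≈ F₁ g D.∘ F₁ f
    F-resp-≈     : ∀ {A B} {f g : A C.⇒ B} → f C.≈ g → F₁ f D.≈ F₁ g

idF : {C : Category o a e} → Functor C C
idF {C = C} = record
  { F₀ = λ A → A
  ; F₁ = λ f → f
  ; identity = IsEquivalence.refl (Category.equiv C)
  ; homomorphism = λ _ _ → IsEquivalence.refl (Category.equiv C)
  ; F-resp-≈ = λ f≈g → f≈g
  }

infixr 9 _∘F_
_∘F_ : {C : Category o a e} {D : Category o′ a′ e′} {E : Category o″ a″ e″} →
       Functor D E → Functor C D → Functor C E
_∘F_ {E = E} G F = record
  { F₀ = λ A → G.F₀ (F.F₀ A)
  ; F₁ = λ f → G.F₁ (F.F₁ f)
  ; identity = IsEquivalence.trans (Category.equiv E) (G.F-resp-≈ F.identity) G.identity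
  ; homomorphism = λ f g →
      IsEquivalence.trans (Category.equiv E)
        (G.F-resp-≈ (F.homomorphism f g)) (G.homomorphism (F.F₁ f) (F.F₁ g))
  ; F-resp-≈ = λ f≈g → G.F-resp-≈ (F.F-resp-≈ f≈g)
  }
  where
    module F = Functor F
    module G = Functor G

infixl 8 _^_
_^_ : Category o a e → Set → Category o a e
C ^ I = record
  { Obj = I → C.Obj
  ; _⇒_ = λ A B → ∀ i → A i C.⇒ B i
  ; _≈_ = λ f g → ∀ i → f i C.≈ g i
  ; id = λ _ → C.id
  ; _∘_ = λ g f i → g i C.∘ f i
  ; equiv = record
    { refl = λ _ → IsEquivalence.refl C.equiv
    ; sym = λ p i → IsEquivalence.sym C.equiv (p i)
    ; trans = λ p q i → IsEquivalence.trans C.equiv (p i) (q i)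
    }
  ; assoc = λ f g h i → C.assoc (f i) (g i) (h i)
  ; identityˡ = λ f i → C.identityˡ (f i)
  ; identityʳ = λ f i → C.identityʳ (f i)
  ; ∘-resp-≈ = λ p q i → C.∘-resp-≈ (p i) (q i)
  }
  where module C = Category C

tuple : {C : Category o a e} {D : Category o′ a′ e′} {I : Set} →
        (I → Functor C D) → Functor C (D ^ I)
tuple Fs = record
  { F₀ = λ A i → Functor.F₀ (Fs i) A
  ; F₁ = λ f i → Functor.F₁ (Fs i) f
  ; identity = λ i → Functor.identity (Fs i)
  ; homomorphism = λ f g i → Functor.homomorphism (Fs i) f g
  ; F-resp-≈ = λ p i → Functor.F-resp-≈ (Fs i) p
  }

proj : (C : Category o a e) {I : Set} → I → Functor (C ^ I) C
proj C i = record
  { F₀ = λ A → A i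
  ; F₁ = λ f → f i
  ; identity = IsEquivalence.refl (Category.equiv C)
  ; homomorphism = λ _ _ → IsEquivalence.refl (Category.equiv C)
  ; F-resp-≈ = λ p → p i
  }

module _ (C : Category o a e) where
  open Category C

  Mono : ∀ {A B} → A ⇒ B → Set (o ⊔ a ⊔ e)
  Mono {A} m = ∀ {Z} (f g : Z ⇒ A) → m ∘ f ≈ m ∘ g → f ≈ g

  IsIso : ∀ {A B} → A ⇒ B → Set (a ⊔ e)
  IsIso {A} {B} f = Σ[ g ∈ B ⇒ A ] (g ∘ f ≈ id) × (f ∘ g ≈ id)

  -- Inclusion of subobjects of B (represented by morphisms into B).
  _⊑_ : ∀ {A A′ B} → A ⇒ B → A′ ⇒ B → Set (a ⊔ e)
  _⊑_ {A} {A′} m m′ = Σ[ u ∈ A ⇒ A′ ] (m′ ∘ u ≈ m)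

  record Filtered : Set (o ⊔ a ⊔ e) where
    field
      inhabitant : Obj
      upperBound : ∀ A B → Σ[ U ∈ Obj ] (A ⇒ U) × (B ⇒ U)
      coequalise : ∀ {A B} (f g : A ⇒ B) →
                   Σ[ U ∈ Obj ] Σ[ h ∈ B ⇒ U ] (h ∘ f ≈ h ∘ g)

record Cocone {J : Category o a e} {C : Category o′ a′ e′} (D : Functor J C)
       : Set (o ⊔ a ⊔ o′ ⊔ a′ ⊔ e′) where
  private
    module J = Category J
    module D = Functor D
  open Category C
  field
    apex    : Obj
    leg     : ∀ j → D.F₀ j ⇒ apex
    commute : ∀ {i j} (u : i J.⇒ j) → leg j ∘ D.F₁ u ≈ leg i

IsColimit : {J : Category o a e} {C : Category o′ a′ e′} {D : Functor J C} →
            Cocone D → Set (o ⊔ a ⊔ o′ ⊔ a′ ⊔ e′)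
IsColimit {C = C} {D} K =
  (L : Cocone D) →
  Σ[ u ∈ apex K ⇒ apex L ] (∀ j → u ∘ leg K j ≈ leg L j) ×
    (∀ (v : apex K ⇒ apex L) → (∀ j → v ∘ leg K j ≈ leg L j) → v ≈ u)
  where
    open Category C
    open Cocone

module _ {C : Category o a e} {D : Category o′ a′ e′} (F : Functor C D) where
  private
    module C = Category C
    module D = Category D
  open Functor F

  PreservesMonos : Set (o ⊔ a ⊔ e ⊔ o′ ⊔ a′ ⊔ e′)
  PreservesMonos = ∀ {A B} (m : A C.⇒ B) → Mono C m → Mono D (F₁ m)

  mapCocone : {J : Category o″ a″ e″} {G : Functor J C} → Cocone G → Cocone (F ∘F G)
  mapCocone K = record
    { apex = F₀ (apex K)
    ; leg = λ j → F₁ (leg K j)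
    ; commute = λ u →
        IsEquivalence.trans D.equiv
          (IsEquivalence.sym D.equiv (homomorphism _ _))
          (F-resp-≈ (commute K u))
    }
    where open Cocone

  -- The index categories range over those that are small relative to ℓ.
  Finitary : (ℓ : Level) → Set (o ⊔ a ⊔ e ⊔ o′ ⊔ a′ ⊔ e′ ⊔ suc ℓ)
  Finitary ℓ = (J : Category ℓ ℓ ℓ) → Filtered J → (G : Functor J C) (K : Cocone G) →
               IsColimit K → IsColimit (mapCocone K)

record Coalgebra {C : Category o a e} (F : Functor C C) : Set (o ⊔ a) where
  constructor coalg
  open Category C
  field
    carrier   : Obj
    structure : carrier ⇒ Functor.F₀ F carrier

module _ {C : Category o a e} (F : Functor C C) where
  open Category C
  open Functor F
  open Coalgebra

  IsHom : (A B : Coalgebra F) → carrier A ⇒ carrier B → Set e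
  IsHom A B h = structure B ∘ h ≈ F₁ h ∘ structure A

  IsCoalgebraIso : (A B : Coalgebra F) → carrier A ⇒ carrier B → Set (a ⊔ e)
  IsCoalgebraIso A B h =
    IsHom A B h ×
    (Σ[ g ∈ carrier B ⇒ carrier A ] IsHom B A g × (g ∘ h ≈ id) × (h ∘ g ≈ id))

  -- Surj is to be the class of surjections in Set, of componentwise
  -- surjections in Set^n.
  module _ (Surj : ∀ {A B} → A ⇒ B → Set s) where

    IsQuotient : (A B : Coalgebra F) → carrier A ⇒ carrier B → Set (e ⊔ s)
    IsQuotient A B h = IsHom A B h × Surj h

    IsSimple : Coalgebra F → Set (o ⊔ a ⊔ e ⊔ s)
    IsSimple A = (B : Coalgebra F) (h : carrier A ⇒ carrier B) →
                 IsQuotient A B h → IsCoalgebraIso A B h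

    RepresentsSimpleQuotient : (A B : Coalgebra F) → carrier A ⇒ carrier B →
                               Set (o ⊔ a ⊔ e ⊔ s)
    RepresentsSimpleQuotient A B q = IsQuotient A B q × IsSimple B

-- Sets are setoids: the category of sets has extensional functions as
-- morphisms, compared pointwise, and thus has quotients.
Sets : (ℓ : Level) → Category (suc ℓ) ℓ ℓ
Sets ℓ = record
  { Obj = Setoid ℓ ℓ
  ; _⇒_ = Func
  ; _≈_ = λ {A} {B} → FuncEq._≈_ A B
  ; id = λ {A} → Identity.function A
  ; _∘_ = λ g f → Composition.function f g
  ; equiv = λ {A} {B} → FuncEq.isEquivalence A B
  ; assoc = λ {A} {B} {C} {D} _ _ _ _ → Setoid.refl D
  ; identityˡ = λ {A} {B} _ _ → Setoid.refl B
  ; identityʳ = λ {A} {B} _ _ → Setoid.refl B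
  ; ∘-resp-≈ = λ {A} {B} {C} {f} f≈f′ g≈g′ x →
      Setoid.trans C (Func.cong f (g≈g′ x)) (f≈f′ _)
  }

Surj : {A B : Setoid ℓ ℓ} → Func A B → Set ℓ
Surj {A = A} {B} f = Surjective (Setoid._≈_ A) (Setoid._≈_ B) (Func.to f)

Surj^ : {I : Set} {A B : I → Setoid ℓ ℓ} → (∀ i → Func (A i) (B i)) → Set ℓ
Surj^ f = ∀ i → Surj (f i)

Finite : Setoid ℓ ℓ → Set ℓ
Finite A = ∃[ k ] Inverse A (≡.setoid (Fin k))

record FunctorSet ℓ : Set (suc ℓ) where
  field
    Sym            : Set ℓ
    arity          : Sym → ℕ
    functor        : (H : Sym) → Functor (Sets ℓ ^ Fin (arity H)) (Sets ℓ)
    preservesMonos : ∀ H → PreservesMonos (functor H)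
    finitary       : ∀ H → Finitary (functor H) ℓ

module _ {ℓ} (𝓗 : FunctorSet ℓ) where
  open FunctorSet 𝓗

  data Term : Set ℓ where
    leaf : Term
    node : (H : Sym) → (Fin (arity H) → Term) → Term

module _ {ℓ} {𝓗 : FunctorSet ℓ} where
  open FunctorSet 𝓗
  open Category (Sets ℓ)

  ⟦_⟧ : Term 𝓗 → Functor (Sets ℓ) (Sets ℓ)
  ⟦ leaf ⟧      = idF
  ⟦ node H Gs ⟧ = functor H ∘F tuple (λ j → ⟦ Gs j ⟧)

  ⟦_⟧₀ : Term 𝓗 → Obj → Obj
  ⟦ t ⟧₀ = Functor.F₀ ⟦ t ⟧

  -- T ∋ S is the type of occurrences of S as a subterm of T, given by the
  -- path from the root of T.
  infixl 5 _▹_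
  data _∋_ (T : Term 𝓗) : Term 𝓗 → Set ℓ where
    root : T ∋ T
    _▹_  : ∀ {H Gs} → T ∋ node H Gs → (j : Fin (arity H)) → T ∋ Gs j

  record NonLeaf (T : Term 𝓗) : Set ℓ where
    constructor nonLeaf
    field
      {sym}  : Sym
      {args} : Fin (arity sym) → Term 𝓗
      path   : T ∋ node sym args

  -- The number of non-leaf subterms is positive for T ≠ (-), so it is
  -- written suc n; the indices 1, …, suc n become the elements of
  -- Fin (suc n), with 1 corresponding to zero.
  indexVia : ∀ {T n} → NonLeaf T ↔ Fin (ℕ.suc n) → ∀ {S} → T ∋ S → Fin (ℕ.suc n)
  indexVia f {leaf}     _ = zero
  indexVia f {node _ _} p = Inverse.to f (nonLeaf p)

  record Numbering (T : Term 𝓗) (n : ℕ) : Set ℓ where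
    field
      bijection : NonLeaf T ↔ Fin (ℕ.suc n)

    index : ∀ {S} → T ∋ S → Fin (ℕ.suc n)
    index = indexVia bijection

    subtermAt : Fin (ℕ.suc n) → NonLeaf T
    subtermAt = Inverse.from bijection

    field
      index-root : index root ≡ zero

    index-subtermAt : ∀ i → index (NonLeaf.path (subtermAt i)) ≡ i
    index-subtermAt = Inverse.strictlyInverseˡ bijection

    subtermAt-index : ∀ {H Gs} (p : T ∋ node H Gs) → subtermAt (index p) ≡ nonLeaf p
    subtermAt-index p = Inverse.strictlyInverseʳ bijection (nonLeaf p)

  -- A possible tuple of arguments to H in one step of Factor, given the map
  -- μ = m_{H(G₁,…,G_k)}: maps mⱼ into GⱼX, which are finite subsets for
  -- Gⱼ ≠ (-) and (up to isomorphism) the identity for Gⱼ = (-), such that μ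
  -- factorises through H(m₁,…,m_k).
  module _ {X : Obj} where

    IsChoiceFor : ∀ {A} (G : Term 𝓗) → A ⇒ ⟦ G ⟧₀ X → Set (suc ℓ)
    IsChoiceFor     leaf       m = Lift (suc ℓ) (IsIso (Sets ℓ) m)
    IsChoiceFor {A} (node _ _) m = Mono (Sets ℓ) m × Finite A

    module _ (H : Sym) (Gs : Fin (arity H) → Term 𝓗) {B : Obj} (μ : B ⇒ ⟦ node H Gs ⟧₀ X) where

      Admissible : (A : Fin (arity H) → Obj) → (∀ j → A j ⇒ ⟦ Gs j ⟧₀ X) → Set (suc ℓ)
      Admissible A m =
        (∀ j → IsChoiceFor (Gs j) (m j)) ×
        _⊑_ (Sets ℓ) μ (Functor.F₁ (functor H) m)

      Minimal : (A : Fin (arity H) → Obj) → (∀ j → A j ⇒ ⟦ Gs j ⟧₀ X) → Set (suc ℓ)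
      Minimal A m =
        Admissible A m ×
        (∀ A′ (m′ : ∀ j → A′ j ⇒ ⟦ Gs j ⟧₀ X) → Admissible A′ m′ →
          (∀ j → _⊑_ (Sets ℓ) (m′ j) (m j)) → (∀ j → _⊑_ (Sets ℓ) (m j) (m′ j)))

  module _ {T : Term 𝓗} {n : ℕ} (f : Numbering T n) where
    open Numbering f

    -- For an occurrence of H(G₁,…,G_k) this is (X_i)_i ↦ H(X_{f(G₁)},…,X_{f(G_k)}).
    flattenAt : NonLeaf T → Functor (Sets ℓ ^ Fin (ℕ.suc n)) (Sets ℓ)
    flattenAt (nonLeaf {H} p) = functor H ∘F tuple (λ j → proj (Sets ℓ) (index (p ▹ j)))

    flatten : Functor (Sets ℓ ^ Fin (ℕ.suc n)) (Sets ℓ ^ Fin (ℕ.suc n))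
    flatten = tuple (λ i → flattenAt (subtermAt i))

    module _ (A : Coalgebra flatten) where
      open Coalgebra A renaming (carrier to X; structure to ξ)

      structureAt : ∀ {H Gs} (p : T ∋ node H Gs) →
                    X (index p) ⇒ Functor.F₀ (flattenAt (nonLeaf p)) X
      structureAt p =
        subst (λ r → X (index p) ⇒ Functor.F₀ (flattenAt r) X)
              (subtermAt-index p) (ξ (index p))

      composite : ∀ {S} (p : T ∋ S) → X (index p) ⇒ ⟦ S ⟧₀ (X zero)
      composite {leaf}      p = id
      composite {node H Gs} p =
        Functor.F₁ (functor H) (λ j → composite (p ▹ j)) ∘ structureAt p

      Comp : Coalgebra ⟦ T ⟧
      Comp = coalg (X zero)
        (subst (λ i → X i ⇒ ⟦ T ⟧₀ (X zero)) index-root (composite root))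

    Comp₁ : (A B : Coalgebra flatten) →
            Category._⇒_ (Sets ℓ ^ Fin (ℕ.suc n))
              (Coalgebra.carrier A) (Coalgebra.carrier B) →
            Coalgebra.carrier (Comp A) ⇒ Coalgebra.carrier (Comp B)
    Comp₁ _ _ h = h zero

    -- An outcome of the (non-deterministic) construction Factor.
    record Factorisation (A : Coalgebra ⟦ T ⟧) : Set (suc ℓ) where
      open Coalgebra A renaming (carrier to X; structure to ξ)
      field
        others : Vector Obj n

      carriers : Vector Obj (ℕ.suc n)
      carriers = X ∷ others

      field
        m       : ∀ {S} (p : T ∋ S) → carriers (index p) ⇒ ⟦ S ⟧₀ X
        m-root  : subst (λ i → carriers i ⇒ ⟦ T ⟧₀ X) index-root (m root) ≈ ξ
        m-leaf  : (p : T ∋ leaf) → m p ≈ id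
        ξ̄       : ∀ {H Gs} (p : T ∋ node H Gs) →
                  carriers (index p) ⇒ Functor.F₀ (flattenAt (nonLeaf p)) carriers
        factor  : ∀ {H Gs} (p : T ∋ node H Gs) →
                  m p ≈ Functor.F₁ (functor H) (λ j → m (p ▹ j)) ∘ ξ̄ p
        minimal : ∀ {H Gs} (p : T ∋ node H Gs) →
                  Minimal H Gs (m p) (λ j → carriers (index (p ▹ j))) (λ j → m (p ▹ j))

      Factor : Coalgebra flatten
      Factor = coalg carriers λ i →
        subst (λ k → carriers k ⇒ Functor.F₀ (flattenAt (subtermAt i)) carriers)
              (index-subtermAt i) (ξ̄ (NonLeaf.path (subtermAt i)))

{-# OPTIONS --safe #-}

-- Comp is functorial and Comp (Factor A) is A, so q zero is a quotient of A.
-- Comp also preserves simplicity: for a quotient h : Comp B ↠ D, identify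
-- elements of the component X_{f(S)} of B when they agree under
-- X_{f(S)} → S X₁ → S D, and elements of X₁ when they agree under h. As the
-- functors preserve monos, this is a congruence on B, hence trivial if B is
-- simple, which makes h injective.
module Submission where

open import Defs
open import Level using (Level)
open import Data.Nat.Base using (ℕ)
open import Data.Fin.Base using (Fin; zero; suc)
open import Data.Product.Base using (_,_; proj₁; proj₂)
open import Function.Base using (id)
open import Function.Bundles using (Func; _⟨$⟩_)
open import Function.Definitions using (Injective)
import Function.Construct.Constant as Constant
import Function.Construct.Identity as Identity
open import Relation.Binary.Bundles using (Setoid)
open import Relation.Binary.Core using (Rel; _⇒_; _⇔_)
import Relation.Binary.Construct.On as On
open import Relation.Binary.PropositionalEquality.Core
  using (_≡_; _≢_; refl; sym; trans; cong; subst)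
import Relation.Binary.Reasoning.Setoid as SetoidReasoning
open import Relation.Nullary.Negation using (contradiction)

private
  variable
    o a e ℓ : Level

-- Injections of setoids, functor images of commuting diagrams, and injective quotients.

Kernel : {A B : Setoid ℓ ℓ} → Func A B → Rel (Setoid.Carrier A) ℓ
Kernel {B = B} f x y = Setoid._≈_ B (f ⟨$⟩ x) (f ⟨$⟩ y)

Inj : {A B : Setoid ℓ ℓ} → Func A B → Set ℓ
Inj {A = A} {B} f = Injective (Setoid._≈_ A) (Setoid._≈_ B) (Func.to f)

-- Cancellation is tested on the constant functions at `x` and `y`. Their domain can be `A` itself,
-- which is inhabited by `x`.
mono⇒injective : {A B : Setoid ℓ ℓ} (m : Func A B) → Mono (Sets ℓ) m → Inj m
mono⇒injective {A = A} m mono {x} {y} mx≈my =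
  mono (Constant.function A A x) (Constant.function A A y) (λ _ → mx≈my) x

preservesInjections : {I : Set} (F : Functor (Sets ℓ ^ I) (Sets ℓ)) → PreservesMonos F →
                      {A B : I → Setoid ℓ ℓ} (m : ∀ i → Func (A i) (B i)) →
                      (∀ i → Inj (m i)) → Inj (Functor.F₁ F m)
preservesInjections F pres m inj =
  mono⇒injective (Functor.F₁ F m) (pres m λ f g m∘f≈m∘g i x → inj i (m∘f≈m∘g i x))

module _ {C : Category o a e} (F : Functor C (Sets ℓ)) where
  private module C = Category C
  open Functor F

  F₁-triangle : ∀ {A B D} (f : A C.⇒ B) (g : B C.⇒ D) (k : A C.⇒ D) → g C.∘ f C.≈ k →
                ∀ x → Setoid._≈_ (F₀ D) (F₁ g ⟨$⟩ (F₁ f ⟨$⟩ x)) (F₁ k ⟨$⟩ x)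
  F₁-triangle {D = D} f g k g∘f≈k x =
    Setoid.trans (F₀ D) (Setoid.sym (F₀ D) (homomorphism f g x)) (F-resp-≈ g∘f≈k x)

  F₁-square : ∀ {A B B′ D} (f : A C.⇒ B) (g : B C.⇒ D) (f′ : A C.⇒ B′) (g′ : B′ C.⇒ D) →
              g C.∘ f C.≈ g′ C.∘ f′ →
              ∀ x → Setoid._≈_ (F₀ D) (F₁ g ⟨$⟩ (F₁ f ⟨$⟩ x)) (F₁ g′ ⟨$⟩ (F₁ f′ ⟨$⟩ x))
  F₁-square {D = D} f g f′ g′ eq x =
    Setoid.trans (F₀ D) (F₁-triangle f g (g′ C.∘ f′) eq x) (homomorphism f′ g′ x)

module _ (F : Functor (Sets ℓ) (Sets ℓ)) (A B : Coalgebra F) where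
  open Coalgebra
  open Functor F
  private
    module A = Setoid (carrier A)
    module B = Setoid (carrier B)

  -- Surjectivity selects preimages, and injectivity makes the selection respect equality. The
  -- inverse is then automatically a homomorphism.
  injectiveQuotient⇒iso : (h : Func (carrier A) (carrier B)) → IsQuotient F Surj A B h →
                          Inj h → IsCoalgebraIso F A B h
  injectiveQuotient⇒iso h (hom , surj) inj = hom , h⁻¹ , hom⁻¹ , h⁻¹∘h , h∘h⁻¹
    where
      h∘h⁻¹ : ∀ y → (h ⟨$⟩ proj₁ (surj y)) B.≈ y
      h∘h⁻¹ y = proj₂ (surj y) A.refl

      h⁻¹ : Func (carrier B) (carrier A)
      h⁻¹ = record
        { to = λ y → proj₁ (surj y)
        ; cong = λ {x} {y} x≈y → inj (B.trans (h∘h⁻¹ x) (B.trans x≈y (B.sym (h∘h⁻¹ y))))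
        }

      h⁻¹∘h : ∀ x → (h⁻¹ ⟨$⟩ (h ⟨$⟩ x)) A.≈ x
      h⁻¹∘h x = inj (h∘h⁻¹ (h ⟨$⟩ x))

      hom⁻¹ : IsHom F B A h⁻¹
      hom⁻¹ y = begin
        structure A ⟨$⟩ (h⁻¹ ⟨$⟩ y)
          ≈⟨ identity (structure A ⟨$⟩ (h⁻¹ ⟨$⟩ y)) ⟨
        F₁ (Identity.function (carrier A)) ⟨$⟩ (structure A ⟨$⟩ (h⁻¹ ⟨$⟩ y))
          ≈⟨ F₁-triangle F h h⁻¹ (Identity.function (carrier A)) h⁻¹∘h
               (structure A ⟨$⟩ (h⁻¹ ⟨$⟩ y)) ⟨
        F₁ h⁻¹ ⟨$⟩ (F₁ h ⟨$⟩ (structure A ⟨$⟩ (h⁻¹ ⟨$⟩ y)))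
          ≈⟨ Func.cong (F₁ h⁻¹) (hom (h⁻¹ ⟨$⟩ y)) ⟨
        F₁ h⁻¹ ⟨$⟩ (structure B ⟨$⟩ (h ⟨$⟩ (h⁻¹ ⟨$⟩ y)))
          ≈⟨ Func.cong (F₁ h⁻¹) (Func.cong (structure B) (h∘h⁻¹ y)) ⟩
        F₁ h⁻¹ ⟨$⟩ (structure B ⟨$⟩ y) ∎
        where open SetoidReasoning (F₀ (carrier A))

-- Functoriality of `Comp`.

module _ {𝓗 : FunctorSet ℓ} {T : Term 𝓗} {n : ℕ} (f : Numbering T n) where
  open FunctorSet 𝓗
  open Coalgebra
  open Numbering f

  module _ (A B : Coalgebra (flatten f))
           (h : ∀ i → Func (carrier A i) (carrier B i)) (hom : IsHom (flatten f) A B h) where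

    structureAt-natural : ∀ {H Gs} (p : T ∋ node H Gs) x →
      Setoid._≈_ (Functor.F₀ (flattenAt f (nonLeaf p)) (carrier B))
        (structureAt f B p ⟨$⟩ (h (index p) ⟨$⟩ x))
        (Functor.F₁ (flattenAt f (nonLeaf p)) h ⟨$⟩ (structureAt f A p ⟨$⟩ x))
    structureAt-natural p = transport (subtermAt-index p)
      where
        -- With the endpoint of the equation generalised to a variable, matching on `refl` removes
        -- both occurrences of `subst`.
        transport : ∀ {r} (eq : subtermAt (index p) ≡ r) x →
          Setoid._≈_ (Functor.F₀ (flattenAt f r) (carrier B))
            (subst (λ r → Func (carrier B (index p)) (Functor.F₀ (flattenAt f r) (carrier B)))
                   eq (structure B (index p)) ⟨$⟩ (h (index p) ⟨$⟩ x))
            (Functor.F₁ (flattenAt f r) h ⟨$⟩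
              (subst (λ r → Func (carrier A (index p)) (Functor.F₀ (flattenAt f r) (carrier A)))
                     eq (structure A (index p)) ⟨$⟩ x))
        transport refl = hom (index p)

    -- Induction on `S`: the square of the structure maps is pasted with the image under `H` of the
    -- squares for the arguments.
    composite-natural : ∀ {S} (p : T ∋ S) x →
      Setoid._≈_ (⟦ S ⟧₀ (carrier B zero))
        (composite f B p ⟨$⟩ (h (index p) ⟨$⟩ x))
        (Functor.F₁ ⟦ S ⟧ (h zero) ⟨$⟩ (composite f A p ⟨$⟩ x))
    composite-natural {leaf} p x = Setoid.refl (carrier B zero)
    composite-natural {node H Gs} p x =
      Setoid.trans (⟦ node H Gs ⟧₀ (carrier B zero))
        (Func.cong (Functor.F₁ (functor H) (λ j → composite f B (p ▹ j)))
          (structureAt-natural p x))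
        (F₁-square (functor H)
          (λ j → h (index (p ▹ j))) (λ j → composite f B (p ▹ j))
          (λ j → composite f A (p ▹ j)) (λ j → Functor.F₁ ⟦ Gs j ⟧ (h zero))
          (λ j → composite-natural (p ▹ j)) (structureAt f A p ⟨$⟩ x))

    Comp₁-hom : IsHom ⟦ T ⟧ (Comp f A) (Comp f B) (Comp₁ f A B h)
    Comp₁-hom = transport index-root
      where
        transport : ∀ {i} (eq : index root ≡ i) x →
          Setoid._≈_ (⟦ T ⟧₀ (carrier B zero))
            (subst (λ i → Func (carrier B i) (⟦ T ⟧₀ (carrier B zero))) eq
                   (composite f B root) ⟨$⟩ (h i ⟨$⟩ x))
            (Functor.F₁ ⟦ T ⟧ (h zero) ⟨$⟩
              (subst (λ i → Func (carrier A i) (⟦ T ⟧₀ (carrier A zero))) eq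
                     (composite f A root) ⟨$⟩ x))
        transport refl = composite-natural root

  -- `Comp` after `Factor`.

  module _ {A : Coalgebra ⟦ T ⟧} (F : Factorisation f A) where
    open Factorisation F

    structureAt-Factor : ∀ {H Gs} (p : T ∋ node H Gs) → structureAt f Factor p ≡ ξ̄ p
    structureAt-Factor p = transport (subtermAt-index p) (index-subtermAt (index p))
      where
        -- The structure is transported once in `Factor` and once in `structureAt`. Once `r` is
        -- `nonLeaf p`, `eq′` is a loop at `index p`, trivial by uniqueness of identity proofs, so
        -- the two inverse laws of the numbering need no coherence.
        transport : ∀ {r} (eq : r ≡ nonLeaf p) (eq′ : index (NonLeaf.path r) ≡ index p) →
          subst (λ r → Func (carriers (index p)) (Functor.F₀ (flattenAt f r) carriers)) eq
            (subst (λ k → Func (carriers k) (Functor.F₀ (flattenAt f r) carriers)) eq′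
              (ξ̄ (NonLeaf.path r)))
          ≡ ξ̄ p
        transport refl refl = refl

    -- The equation `factor` for `m` is the recursion that defines `composite`.
    composite-Factor : ∀ {S} (p : T ∋ S) x →
      Setoid._≈_ (⟦ S ⟧₀ (carrier A)) (composite f Factor p ⟨$⟩ x) (m p ⟨$⟩ x)
    composite-Factor {leaf} p x = Setoid.sym (carrier A) (m-leaf p x)
    composite-Factor {node H Gs} p x = begin
      F₁ (λ j → composite f Factor (p ▹ j)) ⟨$⟩ (structureAt f Factor p ⟨$⟩ x)
        ≡⟨ cong (λ s → F₁ (λ j → composite f Factor (p ▹ j)) ⟨$⟩ (s ⟨$⟩ x))
                (structureAt-Factor p) ⟩
      F₁ (λ j → composite f Factor (p ▹ j)) ⟨$⟩ (ξ̄ p ⟨$⟩ x)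
        ≈⟨ F-resp-≈ (λ j → composite-Factor (p ▹ j)) (ξ̄ p ⟨$⟩ x) ⟩
      F₁ (λ j → m (p ▹ j)) ⟨$⟩ (ξ̄ p ⟨$⟩ x)
        ≈⟨ factor p x ⟨
      m p ⟨$⟩ x ∎
      where
        open Functor (functor H)
        open SetoidReasoning (⟦ node H Gs ⟧₀ (carrier A))

    Comp-Factor : ∀ x → Setoid._≈_ (⟦ T ⟧₀ (carrier A))
      (structure (Comp f Factor) ⟨$⟩ x) (structure A ⟨$⟩ x)
    Comp-Factor x = Setoid.trans (⟦ T ⟧₀ (carrier A)) (transport index-root x) (m-root x)
      where
        transport : ∀ {i} (eq : index root ≡ i) x → Setoid._≈_ (⟦ T ⟧₀ (carrier A))
          (subst (λ i → Func (carriers i) (⟦ T ⟧₀ (carrier A))) eq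
                 (composite f Factor root) ⟨$⟩ x)
          (subst (λ i → Func (carriers i) (⟦ T ⟧₀ (carrier A))) eq (m root) ⟨$⟩ x)
        transport refl = composite-Factor root

-- The congruence on `B` induced by a quotient of `Comp f B`.

depth : {𝓗 : FunctorSet ℓ} {T S : Term 𝓗} → T ∋ S → ℕ
depth root    = 0
depth (p ▹ _) = ℕ.suc (depth p)

subterm : {𝓗 : FunctorSet ℓ} {T : Term 𝓗} → NonLeaf T → Term 𝓗
subterm (nonLeaf {H} {Gs} _) = node H Gs

module _ {𝓗 : FunctorSet ℓ} {H₀ : FunctorSet.Sym 𝓗}
         {Gs₀ : Fin (FunctorSet.arity 𝓗 H₀) → Term 𝓗}
         {n : ℕ} (f : Numbering (node H₀ Gs₀) n) where
  open FunctorSet 𝓗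
  open Category (Sets ℓ) using (_∘_)
  open Coalgebra
  open Numbering f

  private
    T : Term 𝓗
    T = node H₀ Gs₀

  -- The numbering is injective on non-leaf occurrences and already sends the root to zero. Being
  -- the root is expressed by depth, since `p` and `root` have different types.
  index-nonroot : ∀ {H Gs} (p : T ∋ node H Gs) → depth p ≢ 0 → index p ≢ zero
  index-nonroot p d≢0 eq = d≢0 (cong (λ r → depth (NonLeaf.path r)) p≡root)
    where
      p≡root : nonLeaf p ≡ nonLeaf root
      p≡root = trans (sym (subtermAt-index p))
                 (trans (cong subtermAt (trans eq (sym index-root))) (subtermAt-index root))

  module InducedQuotient
    (B : Coalgebra (flatten f)) (D : Coalgebra ⟦ T ⟧)
    (h : Func (carrier B zero) (carrier D)) (hom : IsHom ⟦ T ⟧ (Comp f B) D h) where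

    private
      Y = carrier B
      Z = carrier D

    view : ∀ {S} (p : T ∋ S) → Func (Y (index p)) (⟦ S ⟧₀ Z)
    view {S} p = Functor.F₁ ⟦ S ⟧ h ∘ composite f B p

    -- This is `view` reassociated, with the occurrence and the structure map as parameters, so that
    -- it applies to `structure B i` before any transport.
    viewVia : ∀ {i} (r : NonLeaf T) → Func (Y i) (Functor.F₀ (flattenAt f r) Y) →
              Func (Y i) (⟦ subterm r ⟧₀ Z)
    viewVia (nonLeaf {H} p) s = Functor.F₁ (functor H) (λ j → view (p ▹ j)) ∘ s

    viewAt : ∀ i → Func (Y i) (⟦ subterm (subtermAt i) ⟧₀ Z)
    viewAt i = viewVia (subtermAt i) (structure B i)

    viewVia≈view : ∀ {H Gs} (p : T ∋ node H Gs) x →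
      Setoid._≈_ (⟦ node H Gs ⟧₀ Z)
        (viewVia (nonLeaf p) (structureAt f B p) ⟨$⟩ x) (view p ⟨$⟩ x)
    viewVia≈view {H} {Gs} p x =
      Functor.homomorphism (functor H)
        (λ j → composite f B (p ▹ j)) (λ j → Functor.F₁ ⟦ Gs j ⟧ h) (structureAt f B p ⟨$⟩ x)

    -- Kernels are compared instead of maps because the codomain of `viewVia r s` varies with `r`,
    -- whereas the kernel is always a relation on `Y i`.
    kernel-viewVia : ∀ {i r r′} (eq : r ≡ r′) (s : Func (Y i) (Functor.F₀ (flattenAt f r) Y)) →
      Kernel (viewVia r s) ⇔
      Kernel (viewVia r′ (subst (λ r → Func (Y i) (Functor.F₀ (flattenAt f r) Y)) eq s))
    kernel-viewVia refl s = id , id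

    kernel-viewAt : ∀ {H Gs} (p : T ∋ node H Gs) → Kernel (viewAt (index p)) ⇔ Kernel (view p)
    kernel-viewAt {H} {Gs} p =
      (λ {x} {y} r →
        W.trans (W.sym (viewVia≈view p x)) (W.trans (proj₁ transport r) (viewVia≈view p y))) ,
      (λ {x} {y} r →
        proj₂ transport
          (W.trans (viewVia≈view p x) (W.trans r (W.sym (viewVia≈view p y)))))
      where
        module W = Setoid (⟦ node H Gs ⟧₀ Z)
        transport = kernel-viewVia (subtermAt-index p) (structure B (index p))

    -- Index zero is shared by the root and the leaves; the kernel of h is
    -- contained in that of viewAt zero, but in general not conversely.
    Key : Fin (ℕ.suc n) → Setoid ℓ ℓ
    Key zero      = Z
    Key i@(suc _) = ⟦ subterm (subtermAt i) ⟧₀ Z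

    key : ∀ i → Func (Y i) (Key i)
    key zero      = h
    key i@(suc _) = viewAt i

    -- At zero this is where `h` being a homomorphism enters: the view of the root factors as
    -- `structure D` after `h`.
    kernel-key⇒viewAt : ∀ i → Kernel (key i) ⇒ Kernel (viewAt i)
    kernel-key⇒viewAt (suc _) r = r
    kernel-key⇒viewAt zero {x} {y} r =
      transport index-root
        (W.trans (W.sym (hom x)) (W.trans (Func.cong (structure D) r) (hom y)))
      where
        module W = Setoid (⟦ T ⟧₀ Z)

        transport : ∀ {i} (eq : index root ≡ i) →
          Kernel (Functor.F₁ ⟦ T ⟧ h ∘
                  subst (λ i → Func (Y i) (⟦ T ⟧₀ (Y zero))) eq (composite f B root)) ⇒
          Kernel (viewAt i)
        transport refl = proj₂ (kernel-viewAt root)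

    kernel-viewAt⇒key : ∀ i → i ≢ zero → Kernel (viewAt i) ⇒ Kernel (key i)
    kernel-viewAt⇒key zero    i≢0 = contradiction refl i≢0
    kernel-viewAt⇒key (suc _) _ r = r

    -- At a leaf both maps are `h`. The root is excluded because its key is `h`, which may identify
    -- less than its view; arguments of a node are never the root.
    kernel-key : ∀ {S} (p : T ∋ S) → depth p ≢ 0 → Kernel (key (index p)) ⇔ Kernel (view p)
    kernel-key {leaf}     p _   = id , id
    kernel-key {node _ _} p d≢0 =
      (λ r → proj₁ (kernel-viewAt p) (kernel-key⇒viewAt (index p) r)) ,
      (λ r → kernel-viewAt⇒key (index p) (index-nonroot p d≢0) (proj₂ (kernel-viewAt p) r))

    Quot : Fin (ℕ.suc n) → Setoid ℓ ℓ
    Quot i = On.setoid (Key i) (key i ⟨$⟩_)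

    project : ∀ i → Func (Y i) (Quot i)
    project i = record { to = id ; cong = Func.cong (key i) }

    embed : ∀ {S} (p : T ∋ S) → depth p ≢ 0 → Func (Quot (index p)) (⟦ S ⟧₀ Z)
    embed p d≢0 = record { to = view p ⟨$⟩_ ; cong = proj₁ (kernel-key p d≢0) }

    -- The view is `H` of the embeddings after `H` of the projections after `s`. The embeddings are
    -- injective, so their image under `H` is too and can be cancelled. This makes the structure of
    -- `quotient` well defined.
    kernel-viewVia⇒project : ∀ {i} (r : NonLeaf T) (s : Func (Y i) (Functor.F₀ (flattenAt f r) Y)) →
      Kernel (viewVia r s) ⇒ Kernel (Functor.F₁ (flattenAt f r) project ∘ s)
    kernel-viewVia⇒project (nonLeaf {H} {Gs} p) s {x} {y} v =
      preservesInjections (functor H) (preservesMonos H) embeds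
        (λ j → proj₂ (kernel-key (p ▹ j) λ ()))
        (W.trans (embeds∘projects (s ⟨$⟩ x)) (W.trans v (W.sym (embeds∘projects (s ⟨$⟩ y)))))
      where
        module W = Setoid (⟦ node H Gs ⟧₀ Z)

        embeds : ∀ j → Func (Quot (index (p ▹ j))) (⟦ Gs j ⟧₀ Z)
        embeds j = embed (p ▹ j) λ ()

        embeds∘projects =
          F₁-triangle (functor H) (λ j → project (index (p ▹ j))) embeds (λ j → view (p ▹ j))
            (λ j _ → Setoid.refl (⟦ Gs j ⟧₀ Z))

    quotient : Coalgebra (flatten f)
    quotient = coalg Quot λ i → record
      { to   = λ x → Functor.F₁ (flattenAt f (subtermAt i)) project ⟨$⟩ (structure B i ⟨$⟩ x)
      ; cong = λ r →
          kernel-viewVia⇒project (subtermAt i) (structure B i) (kernel-key⇒viewAt i r)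
      }

    project-isQuotient : IsQuotient (flatten f) Surj^ B quotient project
    project-isQuotient =
      (λ i x → Setoid.refl (Functor.F₀ (flattenAt f (subtermAt i)) Quot)) ,
      (λ i y → y , Func.cong (project i))

  -- Preservation of simplicity, and the conclusion.

  Comp-simple : (B : Coalgebra (flatten f)) → IsSimple (flatten f) Surj^ B →
                IsSimple ⟦ T ⟧ Surj (Comp f B)
  Comp-simple B simple D h isQuotient@(hom , _) =
    injectiveQuotient⇒iso ⟦ T ⟧ (Comp f B) D h isQuotient h-injective
    where
      open InducedQuotient B D h hom
      module Y = Setoid (carrier B zero)

      h-injective : Inj h
      -- `hx≈hy` is by definition equality of `x` and `y` in `Quot zero`; the inverse of `project`
      -- carries it back to `Y zero`.
      h-injective {x} {y} hx≈hy with simple quotient project project-isQuotient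
      ... | _ , g , _ , g∘project≈id , _ =
        Y.trans (Y.sym (g∘project≈id zero x))
          (Y.trans (Func.cong (g zero) hx≈hy) (g∘project≈id zero y))

corollary8p10 : ∀ {ℓ} (𝓗 : FunctorSet ℓ) (T : Term 𝓗) → T ≢ leaf →
    ∀ {n : ℕ} (f : Numbering T n)
    (A : Coalgebra ⟦ T ⟧) → Finite (Coalgebra.carrier A) →
    (F : Factorisation f A) → let FactorA = Factorisation.Factor F in
    (B : Coalgebra (flatten f))
    (q : Category._⇒_ (Sets ℓ ^ Fin (ℕ.suc n)) (Coalgebra.carrier FactorA) (Coalgebra.carrier B)) →
    RepresentsSimpleQuotient (flatten f) Surj^ FactorA B q →
    RepresentsSimpleQuotient ⟦ T ⟧ Surj A (Comp f B) (Comp₁ f FactorA B q)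
corollary8p10 𝓗 leaf T≢leaf = contradiction refl T≢leaf
corollary8p10 𝓗 T@(node _ _) _ f A _ F B q ((hom , surj) , simple) =
  (q₀-hom , surj zero) , Comp-simple f B simple
  where
    open Coalgebra
    open Factorisation F using (Factor)
    module W = Setoid (⟦ T ⟧₀ (carrier B zero))

    q₀-hom : IsHom ⟦ T ⟧ A (Comp f B) (q zero)
    -- Functoriality gives a homomorphism out of `Comp f Factor`, whose structure map agrees with
    -- that of `A`.
    q₀-hom x = W.trans (Comp₁-hom f Factor B q hom x)
      (Func.cong (Functor.F₁ ⟦ T ⟧ (q zero)) (Comp-Factor f F x))
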